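{- There is no regular graph of degree $d\ge3$ with $d\equiv 0$ or $2\pmod 3$, girth $7$, and cyclic excess.
   Context: For an integer $d\ge 1$ define polynomials $G_{d,m}(x)$ by $G_{d,0}(x)=1$, $G_{d,1}(x)=x+1$, and $G_{d,m+1}(x)=xG_{d,m}(x)-(d-1)G_{d,m-1}(x)$ for $m\ge1$. Let $J_n$ be the $n\times n$ all-ones matrix. For a graph on $n\ge3$ vertices, a cycle matrix is the adjacency matrix $B$ of an $n$-cycle on the same vertex set (i.e., for some ordering $v_1,\dots,v_n$ of the vertices, $B_{ij}=1$ iff $v_i,v_j$ are cyclically consecutive, and $0$ otherwise); this cycle need not consist of edges of the graph. A graph $\Gamma$ of order $n$ with adjacency matrix $A$ is a graph of degree $d$, girth $g$ and cyclic excess if $\Gamma$ is $d$-regular with $d\ge3$, has odd girth $g\ge5$, and $G_{d,\lfloor g/2\rfloor}(A)=J_n-B$ for some cycle matrix $B$. -}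

module Defs where

open import Data.Nat using (ℕ; zero; suc; _≤_; _<_; _∸_)
open import Data.Nat.Properties using (_≟_)
open import Data.Bool using (Bool; true; false; if_then_else_; _∨_)
open import Data.Fin using (Fin; toℕ)
open import Data.Fin.Permutation using (Permutation′; _⟨$⟩ʳ_)
open import Data.Integer using (ℤ; +_; _+_; _-_; _*_; 0ℤ; 1ℤ)
open import Data.Product using (Σ; ∃; _×_; _,_)
open import Function.Definitions using (Injective)
open import Relation.Binary.PropositionalEquality using (_≡_)
open import Relation.Nullary using (¬_)
open import Relation.Nullary.Decidable using (⌊_⌋)

record Graph (n : ℕ) : Set where
  field
    adj     : Fin n → Fin n → Bool
    sym     : ∀ i j → adj i j ≡ adj j i
    irrefl  : ∀ i → adj i i ≡ false
open Graph public

Matrix : ℕ → Set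
Matrix n = Fin n → Fin n → ℤ

sumFin : ∀ {n} → (Fin n → ℤ) → ℤ
sumFin {zero}  f = 0ℤ
sumFin {suc n} f = f Data.Fin.zero + sumFin (λ i → f (Data.Fin.suc i))

boolℤ : Bool → ℤ
boolℤ true  = 1ℤ
boolℤ false = 0ℤ

boolℕ : Bool → ℕ
boolℕ true  = 1
boolℕ false = 0

sumFinℕ : ∀ {n} → (Fin n → ℕ) → ℕ
sumFinℕ {zero}  f = 0
sumFinℕ {suc n} f = f Data.Fin.zero Data.Nat.+ sumFinℕ (λ i → f (Data.Fin.suc i))

identity : ∀ {n} → Matrix n
identity i j = boolℤ ⌊ toℕ i ≟ toℕ j ⌋

allOnes : ∀ {n} → Matrix n
allOnes i j = 1ℤ

_⊕_ : ∀ {n} → Matrix n → Matrix n → Matrix n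
(M ⊕ N) i j = M i j + N i j

_⊖_ : ∀ {n} → Matrix n → Matrix n → Matrix n
(M ⊖ N) i j = M i j - N i j

_⊗_ : ∀ {n} → Matrix n → Matrix n → Matrix n
(M ⊗ N) i j = sumFin (λ k → M i k * N k j)

scale : ∀ {n} → ℤ → Matrix n → Matrix n
scale c M i j = c * M i j

adjMatrix : ∀ {n} → Graph n → Matrix n
adjMatrix Γ i j = boolℤ (adj Γ i j)

Gmat : ∀ {n} → ℕ → ℕ → Matrix n → Matrix n
Gmat d zero          A = identity
Gmat d (suc zero)    A = A ⊕ identity
Gmat d (suc (suc m)) A = (A ⊗ Gmat d (suc m) A) ⊖ scale (+ (d ∸ 1)) (Gmat d m A)

degree : ∀ {n} → Graph n → Fin n → ℕ
degree Γ v = sumFinℕ (λ w → boolℕ (adj Γ v w))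

Regular : ∀ {n} → Graph n → ℕ → Set
Regular Γ d = ∀ v → degree Γ v ≡ d

cyclicallyConsecutiveℕ : ℕ → ℕ → ℕ → Bool
cyclicallyConsecutiveℕ k a b =
  ⌊ b ≟ suc a ⌋ ∨ ⌊ a ≟ suc b ⌋ ∨
  (⌊ a ≟ 0 ⌋ Data.Bool.∧ ⌊ b ≟ k ∸ 1 ⌋) ∨ (⌊ b ≟ 0 ⌋ Data.Bool.∧ ⌊ a ≟ k ∸ 1 ⌋)

HasCycleOfLength : ∀ {n} → Graph n → ℕ → Set
HasCycleOfLength {n} Γ k =
  3 ≤ k × Σ (Fin k → Fin n) λ c → Injective _≡_ _≡_ c ×
    (∀ i j → cyclicallyConsecutiveℕ k (toℕ i) (toℕ j) ≡ true → adj Γ (c i) (c j) ≡ true)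

Girth : ∀ {n} → Graph n → ℕ → Set
Girth Γ g = HasCycleOfLength Γ g × (∀ k → k < g → ¬ HasCycleOfLength Γ k)

-- Cycle matrices: π assigns to each vertex its position in an ordering
-- v_1,…,v_n; B_ij = 1 iff v_i and v_j are cyclically consecutive.

cycleMatrix : ∀ {n} → Permutation′ n → Matrix n
cycleMatrix {n} π i j =
  boolℤ (cyclicallyConsecutiveℕ n (toℕ (π ⟨$⟩ʳ i)) (toℕ (π ⟨$⟩ʳ j)))

CyclicExcess : ∀ {n} → Graph n → ℕ → ℕ → Set
CyclicExcess {n} Γ d g =
  3 ≤ n × Regular Γ d × 3 ≤ d × Girth Γ g × Data.Nat._%_ g 2 ≡ 1 × 5 ≤ g ×
  Σ (Permutation′ n) λ π →
    ∀ i j → Gmat d (Data.Nat._/_ g 2) (adjMatrix Γ) i j ≡ (allOnes ⊖ cycleMatrix π) i j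

{-# OPTIONS --safe #-}

-- The excess matrix B is J minus a polynomial in A, and A commutes with J by regularity, so A
-- commutes with B.  Label the vertices by ℤ/n along the cycle of B: then AB = BA says that the
-- entries a(x,y) of A satisfy the discrete wave equation
--   a(x,y-1) + a(x,y+1) = a(x-1,y) + a(x+1,y).
-- Hence a(x+1,y+1) - a(x,y) depends only on x + y, and since the diagonal of A vanishes it is
-- zero whenever x + y is even.  So an edge {x, x+k} with k even can be translated all around the
-- cycle.  If z is a neighbour of x other than x ± k, the wave equation with step k makes x + k
-- adjacent to z + k or z - k, which closes a 4-cycle.  Therefore every edge joins labels of
-- opposite parity, whatever representatives are chosen; Γ is bipartite and has no 7-cycle.

module Submission where

open import Defs
open import Data.Nat using (ℕ; _≤_; _%_)
open import Data.Sum using (_⊎_)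
open import Relation.Binary.PropositionalEquality using (_≡_)
open import Relation.Nullary using (¬_)

import Algebra.Properties.Semiring.Sum as SemiringSum
import Data.Bool as Bool
open import Data.Bool using (Bool; true; false; _∨_; _∧_)
open import Data.Bool.Properties using (∨-zeroʳ; ¬-not)
open import Data.Empty using (⊥)
open import Data.Fin using (Fin; zero; suc; toℕ; fromℕ<)
open import Data.Fin.Patterns using (0F; 1F; 2F; 3F; 4F; 5F; 6F)
open import Data.Fin.Permutation using (Permutation′; _⟨$⟩ʳ_; _⟨$⟩ˡ_; inverseˡ; inverseʳ)
import Data.Fin.Properties as Fin
open import Data.Integer using (ℤ; -_; _+_; _-_; _*_; 0ℤ; 1ℤ) renaming (+_ to nonneg)
import Data.Integer.Properties as ℤ
open import Data.Integer.Tactic.RingSolver using (solve-∀)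
import Data.Nat as ℕ
open import Data.Nat.Base using (parity)
open import Data.Nat.DivMod using (%-distribˡ-+; [m+kn]%n≡m%n; m%n<n; m<n⇒m%n≡m; n%n≡0)
import Data.Nat.Properties as ℕ
import Data.Nat.Tactic.RingSolver as ℕ-Solver
open import Data.Parity using (Parity; 0ℙ; 1ℙ; _⁻¹)
open import Data.Parity.Properties using (suc-homo-⁻¹)
open import Data.Product using (∃; _×_; _,_)
import Data.Sum as Sum
open import Data.Sum using (inj₁; inj₂; [_,_]′)
open import Function using (_∘_)
import Relation.Binary.PropositionalEquality as ≡
open import Relation.Binary.PropositionalEquality
  using (_≢_; refl; trans; cong; cong₂; subst₂; module ≡-Reasoning)
open import Relation.Nullary using (Dec; yes; no; contradiction)
open import Relation.Nullary.Decidable using (⌊_⌋; _×-dec_; ¬?; decidable-stable)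

open SemiringSum ℤ.+-*-semiring using (sum; sum-cong-≗; ∑-comm; *-distribˡ-sum; *-distribʳ-sum)

-- Finite sums of integers.

sumFin≡sum : ∀ {n} (f : Fin n → ℤ) → sumFin f ≡ sum f
sumFin≡sum {ℕ.zero}  f = refl
sumFin≡sum {ℕ.suc n} f = cong (f zero +_) (sumFin≡sum (f ∘ suc))

sumFin-cong : ∀ {n} {f g : Fin n → ℤ} → (∀ k → f k ≡ g k) → sumFin f ≡ sumFin g
sumFin-cong {ℕ.zero}  eq = refl
sumFin-cong {ℕ.suc n} eq = cong₂ _+_ (eq zero) (sumFin-cong (eq ∘ suc))

sumFin-linear : ∀ {n} c (f g : Fin n → ℤ) →
  sumFin (λ k → f k + c * g k) ≡ sumFin f + c * sumFin g
sumFin-linear {ℕ.zero}  c f g = ≡.sym (trans (ℤ.+-identityˡ _) (ℤ.*-zeroʳ c))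
sumFin-linear {ℕ.suc n} c f g = trans
  (cong (f zero + c * g zero +_) (sumFin-linear c (f ∘ suc) (g ∘ suc)))
  (rearrange (f zero) c (g zero) _ _)
  where
  rearrange : ∀ a c b s t → a + c * b + (s + c * t) ≡ a + s + c * (b + t)
  rearrange = solve-∀

sumFin-zero : ∀ {n} {f : Fin n → ℤ} → (∀ k → f k ≡ 0ℤ) → sumFin f ≡ 0ℤ
sumFin-zero {ℕ.zero}  vanish = refl
sumFin-zero {ℕ.suc n} vanish = cong₂ _+_ (vanish zero) (sumFin-zero (vanish ∘ suc))

sumFin-single : ∀ {n} {f : Fin n → ℤ} p → (∀ k → k ≢ p → f k ≡ 0ℤ) → sumFin f ≡ f p
sumFin-single {f = f} zero vanish = trans
  (cong (f zero +_) (sumFin-zero λ k → vanish (suc k) λ ()))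
  (ℤ.+-identityʳ _)
sumFin-single (suc p) vanish = trans
  (cong₂ _+_ (vanish zero λ ()) (sumFin-single p λ k k≢p → vanish (suc k) (k≢p ∘ Fin.suc-injective)))
  (ℤ.+-identityˡ _)

-- Meant for products with a cycle matrix, whose rows and columns have two nonzero entries each, and
-- for bounding a row sum in `thirdNeighbour`.
sumFin-pair : ∀ {n} {f : Fin n → ℤ} p q → p ≢ q →
  (∀ k → k ≢ p → k ≢ q → f k ≡ 0ℤ) → sumFin f ≡ f p + f q
sumFin-pair zero zero p≢q vanish = contradiction refl p≢q
sumFin-pair {f = f} zero (suc q) p≢q vanish =
  cong (f zero +_) (sumFin-single q λ k k≢q → vanish (suc k) (λ ()) (k≢q ∘ Fin.suc-injective))
sumFin-pair {f = f} (suc p) zero p≢q vanish = trans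
  (cong (f zero +_) (sumFin-single p λ k k≢p → vanish (suc k) (k≢p ∘ Fin.suc-injective) (λ ())))
  (ℤ.+-comm (f zero) (f (suc p)))
sumFin-pair (suc p) (suc q) p≢q vanish = trans
  (cong₂ _+_ (vanish zero (λ ()) (λ ()))
    (sumFin-pair p q (p≢q ∘ cong suc) λ k k≢p k≢q →
      vanish (suc k) (k≢p ∘ Fin.suc-injective) (k≢q ∘ Fin.suc-injective)))
  (ℤ.+-identityˡ _)

sumFin-comm : ∀ {m n} (f : Fin m → Fin n → ℤ) →
  sumFin (λ i → sumFin (f i)) ≡ sumFin (λ j → sumFin (λ i → f i j))
sumFin-comm {m} {n} f = begin
  sumFin (λ i → sumFin (f i))          ≡⟨ sumFin≡sum (λ i → sumFin (f i)) ⟩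
  sum (λ i → sumFin (f i))             ≡⟨ sum-cong-≗ (λ i → sumFin≡sum (f i)) ⟩
  sum (λ i → sum (f i))                ≡⟨ ∑-comm {m} {n} f ⟩
  sum (λ j → sum (λ i → f i j))        ≡⟨ sum-cong-≗ (λ j → sumFin≡sum (λ i → f i j)) ⟨
  sum (λ j → sumFin (λ i → f i j))     ≡⟨ sumFin≡sum (λ j → sumFin (λ i → f i j)) ⟨
  sumFin (λ j → sumFin (λ i → f i j))  ∎
  where open ≡-Reasoning

*-distribˡ-sumFin : ∀ {n} c (f : Fin n → ℤ) → c * sumFin f ≡ sumFin (λ k → c * f k)
*-distribˡ-sumFin c f = begin
  c * sumFin f            ≡⟨ cong (c *_) (sumFin≡sum f) ⟩
  c * sum f               ≡⟨ *-distribˡ-sum c f ⟩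
  sum (λ k → c * f k)     ≡⟨ sumFin≡sum (λ k → c * f k) ⟨
  sumFin (λ k → c * f k)  ∎
  where open ≡-Reasoning

*-distribʳ-sumFin : ∀ {n} c (f : Fin n → ℤ) → sumFin f * c ≡ sumFin (λ k → f k * c)
*-distribʳ-sumFin c f = begin
  sumFin f * c            ≡⟨ cong (_* c) (sumFin≡sum f) ⟩
  sum f * c               ≡⟨ *-distribʳ-sum c f ⟩
  sum (λ k → f k * c)     ≡⟨ sumFin≡sum (λ k → f k * c) ⟨
  sumFin (λ k → f k * c)  ∎
  where open ≡-Reasoning

-- Matrices commuting with the adjacency matrix.

⊗-assoc : ∀ {n} (L M N : Matrix n) i j → ((L ⊗ M) ⊗ N) i j ≡ (L ⊗ (M ⊗ N)) i j
⊗-assoc L M N i j = begin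
  sumFin (λ k → sumFin (λ l → L i l * M l k) * N k j)
    ≡⟨ sumFin-cong (λ k → *-distribʳ-sumFin (N k j) (λ l → L i l * M l k)) ⟩
  sumFin (λ k → sumFin (λ l → L i l * M l k * N k j))
    ≡⟨ sumFin-comm (λ k l → L i l * M l k * N k j) ⟩
  sumFin (λ l → sumFin (λ k → L i l * M l k * N k j))
    ≡⟨ sumFin-cong (λ l → sumFin-cong (λ k → ℤ.*-assoc (L i l) (M l k) (N k j))) ⟩
  sumFin (λ l → sumFin (λ k → L i l * (M l k * N k j)))
    ≡⟨ sumFin-cong (λ l → *-distribˡ-sumFin (L i l) (λ k → M l k * N k j)) ⟨
  sumFin (λ l → L i l * sumFin (λ k → M l k * N k j)) ∎
  where open ≡-Reasoning

Commutes : ∀ {n} → Matrix n → Matrix n → Set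
Commutes A M = ∀ i j → (A ⊗ M) i j ≡ (M ⊗ A) i j

-- Bilinearity of the product. The single shape M + cN serves A + I, the subtraction in the
-- recurrence of `Gmat`, and B = J - G. `K` is given entrywise because matrices are functions and
-- only their entries are compared.
commutes-linear : ∀ {n} {A M N K : Matrix n} c → Commutes A M → Commutes A N →
  (∀ i j → K i j ≡ M i j + c * N i j) → Commutes A K
commutes-linear {A = A} {M} {N} {K} c AM NM K≡ i j = begin
  sumFin (λ k → A i k * K k j)
    ≡⟨ sumFin-cong (λ k → trans (cong (A i k *_) (K≡ k j)) (left (A i k) c (M k j) (N k j))) ⟩
  sumFin (λ k → A i k * M k j + c * (A i k * N k j))
    ≡⟨ sumFin-linear c (λ k → A i k * M k j) (λ k → A i k * N k j) ⟩
  (A ⊗ M) i j + c * (A ⊗ N) i j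
    ≡⟨ cong₂ (λ x y → x + c * y) (AM i j) (NM i j) ⟩
  (M ⊗ A) i j + c * (N ⊗ A) i j
    ≡⟨ sumFin-linear c (λ k → M i k * A k j) (λ k → N i k * A k j) ⟨
  sumFin (λ k → M i k * A k j + c * (N i k * A k j))
    ≡⟨ sumFin-cong (λ k → trans (cong (_* A k j) (K≡ i k)) (right (A k j) c (M i k) (N i k))) ⟨
  sumFin (λ k → K i k * A k j) ∎
  where
  open ≡-Reasoning
  left : ∀ a c m n → a * (m + c * n) ≡ a * m + c * (a * n)
  left = solve-∀
  right : ∀ a c m n → (m + c * n) * a ≡ m * a + c * (n * a)
  right = solve-∀

-- A(AM) = A(MA) = (AM)A.
commutes-⊗ : ∀ {n} {A M : Matrix n} → Commutes A M → Commutes A (A ⊗ M)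
commutes-⊗ {A = A} {M} AM i j = trans
  (sumFin-cong λ k → cong (A i k *_) (AM k j))
  (≡.sym (⊗-assoc A M A i j))

identity-diagonal : ∀ {n} (i : Fin n) → identity i i ≡ 1ℤ
identity-diagonal i with toℕ i ℕ.≟ toℕ i
... | yes _ = refl
... | no i≢i = contradiction refl i≢i

identity-offDiagonal : ∀ {n} {i j : Fin n} → i ≢ j → identity i j ≡ 0ℤ
identity-offDiagonal {i = i} {j} i≢j with toℕ i ℕ.≟ toℕ j
... | yes i≡j = contradiction (Fin.toℕ-injective i≡j) i≢j
... | no _ = refl

commutes-identity : ∀ {n} (A : Matrix n) → Commutes A identity
commutes-identity A i j = begin
  (A ⊗ identity) i j
    ≡⟨ sumFin-single j (λ k k≢j → trans (cong (A i k *_) (identity-offDiagonal k≢j)) (ℤ.*-zeroʳ (A i k))) ⟩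
  A i j * identity j j
    ≡⟨ cong (A i j *_) (identity-diagonal j) ⟩
  A i j * 1ℤ
    ≡⟨ ℤ.*-comm (A i j) 1ℤ ⟩
  1ℤ * A i j
    ≡⟨ cong (_* A i j) (identity-diagonal i) ⟨
  identity i i * A i j
    ≡⟨ sumFin-single i (λ k k≢i → cong (_* A k j) (identity-offDiagonal (k≢i ∘ ≡.sym))) ⟨
  (identity ⊗ A) i j ∎
  where open ≡-Reasoning

-- `Gmat d m A` is a polynomial in `A`; the induction follows its two-term recurrence.
commutes-Gmat : ∀ {n} d m (A : Matrix n) → Commutes A (Gmat d m A)
commutes-Gmat d ℕ.zero A = commutes-identity A
commutes-Gmat d (ℕ.suc ℕ.zero) A =
  commutes-linear {M = A} 1ℤ (λ i j → refl) (commutes-identity A)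
    (λ i j → cong (A i j +_) (≡.sym (ℤ.*-identityˡ (identity i j))))
commutes-Gmat d (ℕ.suc (ℕ.suc m)) A =
  commutes-linear {M = A ⊗ Gmat d (ℕ.suc m) A} (- nonneg (d ℕ.∸ 1))
    (commutes-⊗ {M = Gmat d (ℕ.suc m) A} (commutes-Gmat d (ℕ.suc m) A)) (commutes-Gmat d m A)
    (λ i j → cong ((A ⊗ Gmat d (ℕ.suc m) A) i j +_) (ℤ.neg-distribˡ-* (nonneg (d ℕ.∸ 1)) (Gmat d m A i j)))

sumFin-boolℤ : ∀ {n} (b : Fin n → Bool) → sumFin (boolℤ ∘ b) ≡ nonneg (sumFinℕ (boolℕ ∘ b))
sumFin-boolℤ {ℕ.zero}  b = refl
sumFin-boolℤ {ℕ.suc n} b = cong₂ _+_ (boolℤ≡boolℕ (b zero)) (sumFin-boolℤ (b ∘ suc))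
  where
  boolℤ≡boolℕ : ∀ b → boolℤ b ≡ nonneg (boolℕ b)
  boolℤ≡boolℕ true  = refl
  boolℤ≡boolℕ false = refl

-- Every entry of either product is d: one collects row sums of the adjacency matrix, the other
-- column sums, which equal row sums by symmetry.
commutes-allOnes : ∀ {n d} (Γ : Graph n) → Regular Γ d → Commutes (adjMatrix Γ) allOnes
commutes-allOnes {d = d} Γ regular i j = trans
  (trans (sumFin-cong λ k → ℤ.*-identityʳ (adjMatrix Γ i k)) (rowSum i))
  (≡.sym (trans (sumFin-cong λ k → trans (ℤ.*-identityˡ (adjMatrix Γ k j)) (cong boolℤ (sym Γ k j))) (rowSum j)))
  where
  rowSum : ∀ v → sumFin (adjMatrix Γ v) ≡ nonneg d
  rowSum v = trans (sumFin-boolℤ (adj Γ v)) (cong nonneg (regular v))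

-- Solving the excess equation for B gives J - G(A), a combination of two matrices that commute with
-- A.
commutes-cycleMatrix : ∀ {n d} m (Γ : Graph n) (π : Permutation′ n) → Regular Γ d →
  (∀ i j → Gmat d m (adjMatrix Γ) i j ≡ (allOnes ⊖ cycleMatrix π) i j) →
  Commutes (adjMatrix Γ) (cycleMatrix π)
commutes-cycleMatrix {d = d} m Γ π regular excess =
  commutes-linear (- 1ℤ) (commutes-allOnes Γ regular) (commutes-Gmat d m (adjMatrix Γ))
    (λ i j → trans (solved (cycleMatrix π i j)) (cong (λ x → 1ℤ + - 1ℤ * x) (≡.sym (excess i j))))
  where
  solved : ∀ b → b ≡ 1ℤ + - 1ℤ * (1ℤ - b)
  solved = solve-∀

-- Cyclic consecutiveness as succession modulo n.

fromIsYes : ∀ {P : Set} (p? : Dec P) → ⌊ p? ⌋ ≡ true → P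
fromIsYes (yes p) _ = p

≟-refl : ∀ m → ⌊ m ℕ.≟ m ⌋ ≡ true
≟-refl m with m ℕ.≟ m
... | yes _ = refl
... | no m≢m = contradiction refl m≢m

∨-true : ∀ x {y} → x ∨ y ≡ true → x ≡ true ⊎ y ≡ true
∨-true true  _ = inj₁ refl
∨-true false y = inj₂ y

∧-true : ∀ x {y} → x ∧ y ≡ true → x ≡ true × y ≡ true
∧-true true y = refl , y

module _ {n-1 : ℕ} where

  private n = ℕ.suc n-1

  %-+-congˡ : ∀ c x y → x % n ≡ y % n → (c ℕ.+ x) % n ≡ (c ℕ.+ y) % n
  %-+-congˡ c x y eq = begin
    (c ℕ.+ x) % n          ≡⟨ %-distribˡ-+ c x n ⟩
    (c % n ℕ.+ x % n) % n  ≡⟨ cong (λ z → (c % n ℕ.+ z) % n) eq ⟩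
    (c % n ℕ.+ y % n) % n  ≡⟨ %-distribˡ-+ c y n ⟨
    (c ℕ.+ y) % n          ∎
    where open ≡-Reasoning

  -- Adding `c * n-1` acts modulo n as subtracting c, so the cancellation avoids truncated
  -- subtraction.
  %-+-cancelˡ : ∀ c x y → (c ℕ.+ x) % n ≡ (c ℕ.+ y) % n → x % n ≡ y % n
  %-+-cancelˡ c x y eq = trans (≡.sym (absorb x)) (trans (%-+-congˡ (c ℕ.* n-1) (c ℕ.+ x) (c ℕ.+ y) eq) (absorb y))
    where
    absorb : ∀ z → (c ℕ.* n-1 ℕ.+ (c ℕ.+ z)) % n ≡ z % n
    absorb z = trans (cong (_% n) (rearrange c n-1 z)) ([m+kn]%n≡m%n z c n)
      where
      rearrange : ∀ c m z → c ℕ.* m ℕ.+ (c ℕ.+ z) ≡ z ℕ.+ c ℕ.* ℕ.suc m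
      rearrange = ℕ-Solver.solve-∀

  suc-% : ∀ {s t} → t ℕ.< n → t ≡ ℕ.suc s → t ≡ ℕ.suc s % n
  suc-% t<n refl = ≡.sym (m<n⇒m%n≡m t<n)

  -- The first two disjuncts are ordinary succession; the last two are the wrap between n-1 and 0,
  -- which is succession too because n % n is 0.
  consecutive⇒suc% : ∀ {s t} → s ℕ.< n → t ℕ.< n → cyclicallyConsecutiveℕ n s t ≡ true →
    t ≡ ℕ.suc s % n ⊎ s ≡ ℕ.suc t % n
  consecutive⇒suc% {s} {t} s<n t<n c with ∨-true ⌊ t ℕ.≟ ℕ.suc s ⌋ c
  ... | inj₁ t≡ = inj₁ (suc-% t<n (fromIsYes (t ℕ.≟ ℕ.suc s) t≡))
  ... | inj₂ c with ∨-true ⌊ s ℕ.≟ ℕ.suc t ⌋ c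
  ... | inj₁ s≡ = inj₂ (suc-% s<n (fromIsYes (s ℕ.≟ ℕ.suc t) s≡))
  ... | inj₂ c with ∨-true (⌊ s ℕ.≟ 0 ⌋ ∧ ⌊ t ℕ.≟ n-1 ⌋) c
  ... | inj₁ wrap with ∧-true ⌊ s ℕ.≟ 0 ⌋ wrap
  ... | s≡0 , t≡n-1
    rewrite fromIsYes (s ℕ.≟ 0) s≡0 | fromIsYes (t ℕ.≟ n-1) t≡n-1 = inj₂ (≡.sym (n%n≡0 n))
  consecutive⇒suc% {s} {t} s<n t<n c | inj₂ _ | inj₂ _ | inj₂ wrap with ∧-true ⌊ t ℕ.≟ 0 ⌋ wrap
  ... | t≡0 , s≡n-1
    rewrite fromIsYes (t ℕ.≟ 0) t≡0 | fromIsYes (s ℕ.≟ n-1) s≡n-1 = inj₁ (≡.sym (n%n≡0 n))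

  suc-%-cases : ∀ x → ℕ.suc x % n ≡ ℕ.suc (x % n) ⊎ (ℕ.suc x % n ≡ 0 × x % n ≡ n-1)
  suc-%-cases x with ℕ.m≤n⇒m<n∨m≡n (m%n<n x n)
                    | %-+-congˡ 1 x (x % n) (≡.sym (m<n⇒m%n≡m (m%n<n x n)))
  ... | inj₁ r<n | reduce = inj₁ (trans reduce (m<n⇒m%n≡m r<n))
  ... | inj₂ r≡n | reduce =
    inj₂ (trans reduce (trans (cong (_% n) r≡n) (n%n≡0 n)) , ℕ.suc-injective r≡n)

  consecutive-sucʳ : ∀ x → cyclicallyConsecutiveℕ n (x % n) (ℕ.suc x % n) ≡ true
  consecutive-sucʳ x with suc-%-cases x
  ... | inj₁ next rewrite next | ≟-refl (ℕ.suc (x % n)) = refl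
  -- Here n-1 is followed by 0, so the last disjunct is the true one and `∨-zeroʳ` absorbs the
  -- undecided tests before it.
  ... | inj₂ (wrap₀ , wrap₁)
    rewrite wrap₀ | wrap₁ | ≟-refl n-1 | ∨-zeroʳ (⌊ n-1 ℕ.≟ 0 ⌋ ∧ ⌊ 0 ℕ.≟ n-1 ⌋)
          | ∨-zeroʳ ⌊ n-1 ℕ.≟ 1 ⌋ = refl

  consecutive-sucˡ : ∀ x → cyclicallyConsecutiveℕ n (ℕ.suc x % n) (x % n) ≡ true
  consecutive-sucˡ x with suc-%-cases x
  ... | inj₁ next
    rewrite next | ≟-refl (ℕ.suc (x % n)) = ∨-zeroʳ ⌊ x % n ℕ.≟ ℕ.suc (ℕ.suc (x % n)) ⌋
  ... | inj₂ (wrap₀ , wrap₁)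
    rewrite wrap₀ | wrap₁ | ≟-refl n-1 = ∨-zeroʳ ⌊ n-1 ℕ.≟ 1 ⌋

  -- Vertices labelled by their positions on the cycle.

  module CyclicOrder (3≤n : 3 ≤ n) (π : Permutation′ n) where

    position : Fin n → ℕ
    position i = toℕ (π ⟨$⟩ʳ i)

    -- Defined on all naturals by reduction modulo n, so that labels can be added freely; `position`
    -- returns the representative below n.
    vertex : ℕ → Fin n
    vertex x = π ⟨$⟩ˡ fromℕ< (m%n<n x n)

    position-vertex : ∀ x → position (vertex x) ≡ x % n
    position-vertex x = trans (cong toℕ (inverseʳ π)) (Fin.toℕ-fromℕ< (m%n<n x n))

    vertex-cong : ∀ x y → x % n ≡ y % n → vertex x ≡ vertex y
    vertex-cong x y eq = cong (π ⟨$⟩ˡ_) (Fin.fromℕ<-cong _ _ eq _ _)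

    vertex-injective : ∀ x y → vertex x ≡ vertex y → x % n ≡ y % n
    vertex-injective x y eq =
      trans (≡.sym (position-vertex x)) (trans (cong position eq) (position-vertex y))

    vertex-position : ∀ i → vertex (position i) ≡ i
    vertex-position i = trans
      (cong (π ⟨$⟩ˡ_) (Fin.toℕ-injective
        (trans (Fin.toℕ-fromℕ< _) (m<n⇒m%n≡m (Fin.toℕ<n (π ⟨$⟩ʳ i))))))
      (inverseˡ π)

    vertex-+-congˡ : ∀ c x y → vertex x ≡ vertex y → vertex (c ℕ.+ x) ≡ vertex (c ℕ.+ y)
    vertex-+-congˡ c x y eq =
      vertex-cong (c ℕ.+ x) (c ℕ.+ y) (%-+-congˡ c x y (vertex-injective x y eq))

    vertex-+-cancelˡ : ∀ c x y → vertex (c ℕ.+ x) ≡ vertex (c ℕ.+ y) → vertex x ≡ vertex y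
    vertex-+-cancelˡ c x y eq =
      vertex-cong x y (%-+-cancelˡ c x y (vertex-injective (c ℕ.+ x) (c ℕ.+ y) eq))

    vertex-periodic : ∀ m x → vertex (m ℕ.* n ℕ.+ x) ≡ vertex x
    vertex-periodic m x = vertex-cong (m ℕ.* n ℕ.+ x) x
      (trans (cong (_% n) (ℕ.+-comm (m ℕ.* n) x)) ([m+kn]%n≡m%n x m n))

    -- Since n is at least 3, the residue of 2 is nonzero. Hence the two cycle neighbours of a label
    -- are distinct, as `sumFin-pair` requires.
    vertex≢2+ : ∀ x → vertex x ≢ vertex (2 ℕ.+ x)
    vertex≢2+ x eq = contradiction 0≡2 λ ()
      where
      0≡2 : 0 ≡ 2
      0≡2 = trans
        (%-+-cancelˡ x 0 2 (trans (cong (_% n) (ℕ.+-identityʳ x))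
          (trans (vertex-injective x (2 ℕ.+ x) eq) (cong (_% n) (ℕ.+-comm 2 x)))))
        (m<n⇒m%n≡m 3≤n)

    Consecutive : Fin n → Fin n → Set
    Consecutive i j = cyclicallyConsecutiveℕ n (position i) (position j) ≡ true

    consecutive-nextʳ : ∀ x → Consecutive (vertex x) (vertex (ℕ.suc x))
    consecutive-nextʳ x = subst₂ (λ s t → cyclicallyConsecutiveℕ n s t ≡ true)
      (≡.sym (position-vertex x)) (≡.sym (position-vertex (ℕ.suc x))) (consecutive-sucʳ x)

    consecutive-nextˡ : ∀ x → Consecutive (vertex (ℕ.suc x)) (vertex x)
    consecutive-nextˡ x = subst₂ (λ s t → cyclicallyConsecutiveℕ n s t ≡ true)
      (≡.sym (position-vertex (ℕ.suc x))) (≡.sym (position-vertex x)) (consecutive-sucˡ x)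

    next : ∀ i j → position j ≡ ℕ.suc (position i) % n → j ≡ vertex (ℕ.suc (position i))
    next i j eq = trans (≡.sym (vertex-position j))
      (vertex-cong (position j) (ℕ.suc (position i))
        (trans (m<n⇒m%n≡m (Fin.toℕ<n (π ⟨$⟩ʳ j))) eq))

    consecutive⇒next : ∀ i j → Consecutive i j →
      j ≡ vertex (ℕ.suc (position i)) ⊎ i ≡ vertex (ℕ.suc (position j))
    consecutive⇒next i j c with consecutive⇒suc% (Fin.toℕ<n (π ⟨$⟩ʳ i)) (Fin.toℕ<n (π ⟨$⟩ʳ j)) c
    ... | inj₁ eq = inj₁ (next i j eq)
    ... | inj₂ eq = inj₂ (next j i eq)

    precedes⇒≡ : ∀ k y → vertex (ℕ.suc y) ≡ vertex (ℕ.suc (position k)) → k ≡ vertex y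
    precedes⇒≡ k y eq = trans (≡.sym (vertex-position k)) (≡.sym (vertex-+-cancelˡ 1 y (position k) eq))

    succeeds⇒≡ : ∀ k y → k ≡ vertex (ℕ.suc (position (vertex (ℕ.suc y)))) → k ≡ vertex (2 ℕ.+ y)
    succeeds⇒≡ k y eq = trans eq
      (vertex-+-congˡ 1 (position (vertex (ℕ.suc y))) (ℕ.suc y) (vertex-position (vertex (ℕ.suc y))))

    consecutive-vertexʳ : ∀ k y → Consecutive k (vertex (ℕ.suc y)) →
      k ≡ vertex y ⊎ k ≡ vertex (2 ℕ.+ y)
    consecutive-vertexʳ k y c =
      Sum.map (precedes⇒≡ k y) (succeeds⇒≡ k y) (consecutive⇒next k _ c)

    consecutive-vertexˡ : ∀ k y → Consecutive (vertex (ℕ.suc y)) k →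
      k ≡ vertex y ⊎ k ≡ vertex (2 ℕ.+ y)
    consecutive-vertexˡ k y c =
      Sum.map (precedes⇒≡ k y) (succeeds⇒≡ k y) (Sum.swap (consecutive⇒next _ k c))

    private
      B = cycleMatrix π

      boolℤ-false : ∀ b → b ≢ true → boolℤ b ≡ 0ℤ
      boolℤ-false b b≢true = cong boolℤ (¬-not b≢true)

    -- Column y + 1 of B has its ones at the cycle neighbours y and y + 2. Together with
    -- `cycleMatrix-⊗` this turns AB = BA into the wave equation.
    ⊗-cycleMatrix : ∀ (A : Matrix n) i y →
      (A ⊗ B) i (vertex (ℕ.suc y)) ≡ A i (vertex y) + A i (vertex (2 ℕ.+ y))
    ⊗-cycleMatrix A i y = trans
      (sumFin-pair (vertex y) (vertex (2 ℕ.+ y)) (vertex≢2+ y) vanish)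
      (cong₂ _+_ (unit (vertex y) (consecutive-nextʳ y))
                 (unit (vertex (2 ℕ.+ y)) (consecutive-nextˡ (ℕ.suc y))))
      where
      j = vertex (ℕ.suc y)
      unit : ∀ k → Consecutive k j → A i k * B k j ≡ A i k
      unit k c = trans (cong (λ b → A i k * boolℤ b) c) (ℤ.*-identityʳ (A i k))
      vanish : ∀ k → k ≢ vertex y → k ≢ vertex (2 ℕ.+ y) → A i k * B k j ≡ 0ℤ
      vanish k k≢p k≢q = trans
        (cong (A i k *_) (boolℤ-false _ ([ k≢p , k≢q ]′ ∘ consecutive-vertexʳ k y)))
        (ℤ.*-zeroʳ (A i k))

    cycleMatrix-⊗ : ∀ (A : Matrix n) x j →
      (B ⊗ A) (vertex (ℕ.suc x)) j ≡ A (vertex x) j + A (vertex (2 ℕ.+ x)) j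
    cycleMatrix-⊗ A x j = trans
      (sumFin-pair (vertex x) (vertex (2 ℕ.+ x)) (vertex≢2+ x) vanish)
      (cong₂ _+_ (unit (vertex x) (consecutive-nextˡ x))
                 (unit (vertex (2 ℕ.+ x)) (consecutive-nextʳ (ℕ.suc x))))
      where
      i = vertex (ℕ.suc x)
      unit : ∀ k → Consecutive i k → B i k * A k j ≡ A k j
      unit k c = trans (cong (λ b → boolℤ b * A k j) c) (ℤ.*-identityˡ (A k j))
      vanish : ∀ k → k ≢ vertex x → k ≢ vertex (2 ℕ.+ x) → B i k * A k j ≡ 0ℤ
      vanish k k≢p k≢q =
        cong (_* A k j) (boolℤ-false _ ([ k≢p , k≢q ]′ ∘ consecutive-vertexˡ k x))

-- The discrete wave equation.

-- Indices are shifted so that no subtraction occurs: the centre of the stencil is (1 + x , 1 + y).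
module DiscreteWave (a : ℕ → ℕ → ℤ)
  (wave : ∀ x y → a (1 ℕ.+ x) y + a (1 ℕ.+ x) (2 ℕ.+ y) ≡ a x (1 ℕ.+ y) + a (2 ℕ.+ x) (1 ℕ.+ y))
  where

  -- By the wave equation this diagonal difference depends only on x + y.
  Δ : ℕ → ℕ → ℤ
  Δ x y = a (1 ℕ.+ x) (1 ℕ.+ y) - a x y

  Δ-antidiagonal : ∀ i x y → Δ (i ℕ.+ x) y ≡ Δ x (i ℕ.+ y)
  Δ-antidiagonal ℕ.zero x y = refl
  Δ-antidiagonal (ℕ.suc i) x y = begin
    -- One instance of the wave equation, with a term of each side moved across.
    Δ (1 ℕ.+ (i ℕ.+ x)) y  ≡⟨ solved (a (1 ℕ.+ (i ℕ.+ x)) y) (a (1 ℕ.+ (i ℕ.+ x)) (2 ℕ.+ y))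
                                        (a (i ℕ.+ x) (1 ℕ.+ y)) (a (2 ℕ.+ (i ℕ.+ x)) (1 ℕ.+ y))
                                        (wave (i ℕ.+ x) y) ⟩
    Δ (i ℕ.+ x) (1 ℕ.+ y)  ≡⟨ Δ-antidiagonal i x (1 ℕ.+ y) ⟩
    Δ x (i ℕ.+ (1 ℕ.+ y))  ≡⟨ cong (Δ x) (ℕ.+-suc i y) ⟩
    Δ x (1 ℕ.+ (i ℕ.+ y))  ∎
    where
    open ≡-Reasoning
    solved : ∀ p q r s → p + q ≡ r + s → s - p ≡ q - r
    solved p q r s eq = begin
      s - p              ≡⟨ left r s p ⟩
      (r + s) - (r + p)  ≡⟨ cong (_- (r + p)) eq ⟨
      (p + q) - (r + p)  ≡⟨ right p q r ⟩
      q - r              ∎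
      where
      left : ∀ r s p → s - p ≡ (r + s) - (r + p)
      left = solve-∀
      right : ∀ p q r → (p + q) - (r + p) ≡ q - r
      right = solve-∀

  step : ∀ x y → a (1 ℕ.+ x) (1 ℕ.+ y) ≡ a x y + Δ x y
  step x y = regroup (a (1 ℕ.+ x) (1 ℕ.+ y)) (a x y)
    where
    regroup : ∀ s t → s ≡ t + (s - t)
    regroup = solve-∀

  -- The parallelogram identity for the wave equation: the four points are the corners of a tilted
  -- rectangle with sides k(1,1) and i(1,-1), and opposite corners have equal sums. Growing k by one
  -- adds a `Δ` to each side, at points with the same coordinate sum. The case i = k is the wave
  -- equation with step k.
  rectangle : ∀ k i x y →
    a (k ℕ.+ (i ℕ.+ x)) (k ℕ.+ y) + a x (i ℕ.+ y) ≡ a (i ℕ.+ x) y + a (k ℕ.+ x) (k ℕ.+ (i ℕ.+ y))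
  rectangle ℕ.zero i x y = refl
  rectangle (ℕ.suc k) i x y = begin
    a (1 ℕ.+ p) (1 ℕ.+ q) + a x (i ℕ.+ y)
      ≡⟨ cong (_+ a x (i ℕ.+ y)) (step p q) ⟩
    a p q + Δ p q + a x (i ℕ.+ y)
      ≡⟨ swap-right (a p q) (Δ p q) (a x (i ℕ.+ y)) ⟩
    a p q + a x (i ℕ.+ y) + Δ p q
      ≡⟨ cong₂ _+_ (rectangle k i x y) same-sum ⟩
    a (i ℕ.+ x) y + a r s + Δ r s
      ≡⟨ ℤ.+-assoc (a (i ℕ.+ x) y) (a r s) (Δ r s) ⟩
    a (i ℕ.+ x) y + (a r s + Δ r s)
      ≡⟨ cong (λ z → a (i ℕ.+ x) y + z) (step r s) ⟨
    a (i ℕ.+ x) y + a (1 ℕ.+ r) (1 ℕ.+ s) ∎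
    where
    open ≡-Reasoning
    p = k ℕ.+ (i ℕ.+ x)
    q = k ℕ.+ y
    r = k ℕ.+ x
    s = k ℕ.+ (i ℕ.+ y)
    swap-right : ∀ t u w → t + u + w ≡ t + w + u
    swap-right = solve-∀
    exchange : ∀ k i x → k ℕ.+ (i ℕ.+ x) ≡ i ℕ.+ (k ℕ.+ x)
    exchange = ℕ-Solver.solve-∀
    same-sum : Δ p q ≡ Δ r s
    same-sum = begin
      Δ p q                    ≡⟨ cong (λ z → Δ z q) (exchange k i x) ⟩
      Δ (i ℕ.+ (k ℕ.+ x)) q    ≡⟨ Δ-antidiagonal i (k ℕ.+ x) q ⟩
      Δ r (i ℕ.+ (k ℕ.+ y))    ≡⟨ cong (Δ r) (exchange k i y) ⟨
      Δ r s                    ∎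

  module _ (diagonal : ∀ x → a x x ≡ 0ℤ) where

    -- Each diagonal step changes the entry by `Δ` at (z, 2i + z). Its coordinate sum is even, so
    -- this is also `Δ` at the diagonal point (i + z, i + z), where it vanishes.
    translate : ∀ i j x → a (j ℕ.+ x) (i ℕ.+ i ℕ.+ (j ℕ.+ x)) ≡ a x (i ℕ.+ i ℕ.+ x)
    translate i ℕ.zero x = refl
    translate i (ℕ.suc j) x = begin
      a (1 ℕ.+ z) (i ℕ.+ i ℕ.+ (1 ℕ.+ z))
        ≡⟨ cong (a (1 ℕ.+ z)) (ℕ.+-suc (i ℕ.+ i) z) ⟩
      a (1 ℕ.+ z) (1 ℕ.+ (i ℕ.+ i ℕ.+ z))
        ≡⟨ step z (i ℕ.+ i ℕ.+ z) ⟩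
      a z (i ℕ.+ i ℕ.+ z) + Δ z (i ℕ.+ i ℕ.+ z)
        ≡⟨ cong₂ _+_ (translate i j x) Δ≡0 ⟩
      a x (i ℕ.+ i ℕ.+ x) + 0ℤ
        ≡⟨ ℤ.+-identityʳ _ ⟩
      a x (i ℕ.+ i ℕ.+ x) ∎
      where
      open ≡-Reasoning
      z = j ℕ.+ x
      Δ≡0 : Δ z (i ℕ.+ i ℕ.+ z) ≡ 0ℤ
      Δ≡0 = begin
        Δ z (i ℕ.+ i ℕ.+ z)      ≡⟨ cong (Δ z) (ℕ.+-assoc i i z) ⟩
        Δ z (i ℕ.+ (i ℕ.+ z))    ≡⟨ Δ-antidiagonal i z (i ℕ.+ z) ⟨
        Δ (i ℕ.+ z) (i ℕ.+ z)    ≡⟨ cong₂ _-_ (diagonal (1 ℕ.+ (i ℕ.+ z))) (diagonal (i ℕ.+ z)) ⟩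
        0ℤ                       ∎

-- Four-cycles and third neighbours.

adjacent⇒≢ : ∀ {n} (Γ : Graph n) {i j} → adj Γ i j ≡ true → i ≢ j
adjacent⇒≢ Γ {i} ij refl = contradiction (trans (≡.sym ij) (irrefl Γ i)) λ ()

-- Adjacent corners differ because there are no loops, so distinctness has to be assumed only for
-- the two diagonals.
fourCycle : ∀ {n} (Γ : Graph n) {p q r s} →
  adj Γ p q ≡ true → adj Γ q r ≡ true → adj Γ r s ≡ true → adj Γ s p ≡ true →
  p ≢ r → q ≢ s → HasCycleOfLength Γ 4
fourCycle {n} Γ {p} {q} {r} {s} pq qr rs sp p≢r q≢s =
  ℕ.s≤s (ℕ.s≤s (ℕ.s≤s ℕ.z≤n)) , c , (λ {i} {j} → injective i j) , edge
  where
  c : Fin 4 → Fin n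
  c 0F = p
  c 1F = q
  c 2F = r
  c 3F = s

  flip : ∀ {i j} → adj Γ i j ≡ true → adj Γ j i ≡ true
  flip {i} {j} ij = trans (sym Γ j i) ij

  injective : ∀ i j → c i ≡ c j → i ≡ j
  injective 0F 0F _ = refl
  injective 0F 1F eq = contradiction eq (adjacent⇒≢ Γ pq)
  injective 0F 2F eq = contradiction eq p≢r
  injective 0F 3F eq = contradiction (≡.sym eq) (adjacent⇒≢ Γ sp)
  injective 1F 0F eq = contradiction (≡.sym eq) (adjacent⇒≢ Γ pq)
  injective 1F 1F _ = refl
  injective 1F 2F eq = contradiction eq (adjacent⇒≢ Γ qr)
  injective 1F 3F eq = contradiction eq q≢s
  injective 2F 0F eq = contradiction (≡.sym eq) p≢r
  injective 2F 1F eq = contradiction (≡.sym eq) (adjacent⇒≢ Γ qr)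
  injective 2F 2F _ = refl
  injective 2F 3F eq = contradiction eq (adjacent⇒≢ Γ rs)
  injective 3F 0F eq = contradiction eq (adjacent⇒≢ Γ sp)
  injective 3F 1F eq = contradiction (≡.sym eq) q≢s
  injective 3F 2F eq = contradiction (≡.sym eq) (adjacent⇒≢ Γ rs)
  injective 3F 3F _ = refl

  edge : ∀ i j → cyclicallyConsecutiveℕ 4 (toℕ i) (toℕ j) ≡ true → adj Γ (c i) (c j) ≡ true
  edge 0F 1F _ = pq
  edge 1F 0F _ = flip pq
  edge 1F 2F _ = qr
  edge 2F 1F _ = flip qr
  edge 2F 3F _ = rs
  edge 3F 2F _ = flip rs
  edge 3F 0F _ = sp
  edge 0F 3F _ = flip sp
  edge 0F 0F ()
  edge 0F 2F ()
  edge 1F 1F ()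
  edge 1F 3F ()
  edge 2F 0F ()
  edge 2F 2F ()
  edge 3F 1F ()
  edge 3F 3F ()

-- Otherwise the row of u is supported on p and q, and its sum d would be at most 2. The vertices p
-- and q may coincide, hence the case split in `few`.
thirdNeighbour : ∀ {n d} (Γ : Graph n) → Regular Γ d → 3 ≤ d → ∀ u p q →
  ∃ λ z → adj Γ u z ≡ true × z ≢ p × z ≢ q
thirdNeighbour {n} {d} Γ regular 3≤d u p q = decidable-stable
  (Fin.any? λ z → (adj Γ u z Bool.≟ true) ×-dec ¬? (z Fin.≟ p) ×-dec ¬? (z Fin.≟ q))
  λ none → few (λ z z≢p z≢q → cong boolℤ (¬-not λ uz → none (z , uz , z≢p , z≢q)))
  where
  A = adjMatrix Γ u

  d≡ : nonneg d ≡ sumFin A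
  d≡ = ≡.sym (trans (sumFin-boolℤ (adj Γ u)) (cong nonneg (regular u)))

  degree≰2 : ∀ m → m ℕ.≤ 2 → nonneg d ≢ nonneg m
  degree≰2 m m≤2 eq = ℕ.<⇒≱ (ℕ.≤-trans 3≤d (ℕ.≤-reflexive (ℤ.+-injective eq))) m≤2

  one : ∀ b → nonneg d ≢ boolℤ b
  one true  = degree≰2 1 (ℕ.s≤s ℕ.z≤n)
  one false = degree≰2 0 ℕ.z≤n

  two : ∀ b c → nonneg d ≢ boolℤ b + boolℤ c
  two true  true  = degree≰2 2 ℕ.≤-refl
  two true  false = one true
  two false true  = one true
  two false false = one false

  few : (∀ z → z ≢ p → z ≢ q → A z ≡ 0ℤ) → ⊥
  few vanish with p Fin.≟ q
  ... | yes refl = one (adj Γ u p) (trans d≡ (sumFin-single p λ z z≢p → vanish z z≢p z≢p))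
  ... | no p≢q = two (adj Γ u p) (adj Γ u q) (trans d≡ (sumFin-pair p q p≢q vanish))

-- Parity of labels and two-colourings.

even⇒double : ∀ x → parity x ≡ 0ℙ → ∃ λ i → x ≡ i ℕ.+ i
even⇒double ℕ.zero _ = 0 , refl
even⇒double (ℕ.suc (ℕ.suc x)) even with even⇒double x even
... | i , refl = ℕ.suc i , cong ℕ.suc (≡.sym (ℕ.+-suc i i))

-- Both numbers are lowered together until one is 0 and the other is even. The offset is written
-- `i + i` to match `translate`.
sameParity⇒evenOffset : ∀ x y → parity x ≡ parity y →
  (∃ λ i → y ≡ i ℕ.+ i ℕ.+ x) ⊎ (∃ λ i → x ≡ i ℕ.+ i ℕ.+ y)
sameParity⇒evenOffset ℕ.zero y eq with even⇒double y (≡.sym eq)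
... | i , refl = inj₁ (i , ≡.sym (ℕ.+-identityʳ _))
sameParity⇒evenOffset (ℕ.suc x) ℕ.zero eq with even⇒double (ℕ.suc x) eq
... | i , x≡ = inj₂ (i , trans x≡ (≡.sym (ℕ.+-identityʳ _)))
sameParity⇒evenOffset (ℕ.suc x) (ℕ.suc y) eq =
  Sum.map (λ (i , y≡) → i , trans (cong ℕ.suc y≡) (≡.sym (ℕ.+-suc _ x)))
          (λ (i , x≡) → i , trans (cong ℕ.suc x≡) (≡.sym (ℕ.+-suc _ y)))
          (sameParity⇒evenOffset x y
            (trans (≡.sym (suc-homo-⁻¹ x)) (trans (cong _⁻¹ eq) (suc-homo-⁻¹ y))))

≢-≢⇒≡ : ∀ {p q r : Parity} → p ≢ q → q ≢ r → p ≡ r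
≢-≢⇒≡ {0ℙ} {_}  {0ℙ} _ _ = refl
≢-≢⇒≡ {1ℙ} {_}  {1ℙ} _ _ = refl
≢-≢⇒≡ {0ℙ} {0ℙ} {1ℙ} p≢q _ = contradiction refl p≢q
≢-≢⇒≡ {0ℙ} {1ℙ} {1ℙ} _ q≢r = contradiction refl q≢r
≢-≢⇒≡ {1ℙ} {1ℙ} {0ℙ} p≢q _ = contradiction refl p≢q
≢-≢⇒≡ {1ℙ} {0ℙ} {0ℙ} _ q≢r = contradiction refl q≢r

-- Colours alternate along the cycle, so corners 0, 2, 4 and 6 share a colour, yet the closing edge
-- joins 6 to 0.
bipartite⇒no7Cycle : ∀ {n} (Γ : Graph n) (colour : Fin n → Parity) →
  (∀ i j → adj Γ i j ≡ true → colour i ≢ colour j) → ¬ HasCycleOfLength Γ 7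
bipartite⇒no7Cycle Γ colour proper (_ , c , _ , edge) =
  proper _ _ (edge 6F 0F refl) (≡.sym (trans 0≡2 (trans 2≡4 4≡6)))
  where
  0≡2 : colour (c 0F) ≡ colour (c 2F)
  0≡2 = ≢-≢⇒≡ (proper _ _ (edge 0F 1F refl)) (proper _ _ (edge 1F 2F refl))
  2≡4 : colour (c 2F) ≡ colour (c 4F)
  2≡4 = ≢-≢⇒≡ (proper _ _ (edge 2F 3F refl)) (proper _ _ (edge 3F 4F refl))
  4≡6 : colour (c 4F) ≡ colour (c 6F)
  4≡6 = ≢-≢⇒≡ (proper _ _ (edge 4F 5F refl)) (proper _ _ (edge 5F 6F refl))

-- Exclusion of edges with even offset, and the conclusion.

boolℤ-injective : ∀ {b c} → boolℤ b ≡ boolℤ c → b ≡ c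
boolℤ-injective {true}  {true}  _ = refl
boolℤ-injective {false} {false} _ = refl

-- A sum of zeros and ones with a term 1 is positive. This reads an adjacency off the rectangle
-- identity.
boolℤ-sum : ∀ p {q} r {s} → boolℤ p + boolℤ q ≡ boolℤ r + boolℤ s →
  q ≡ true → r ≡ true ⊎ s ≡ true
boolℤ-sum _     true           _ _ = inj₁ refl
boolℤ-sum _     false {true}   _ _ = inj₂ refl
boolℤ-sum true  {true} false {false} () _
boolℤ-sum false {true} false {false} () _

module _ {n-1 d : ℕ} (3≤n : 3 ≤ ℕ.suc n-1) (Γ : Graph (ℕ.suc n-1)) (π : Permutation′ (ℕ.suc n-1))
  (regular : Regular Γ d) (3≤d : 3 ≤ d) (no4Cycle : ¬ HasCycleOfLength Γ 4)
  (commutes : Commutes (adjMatrix Γ) (cycleMatrix π)) where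

  open CyclicOrder 3≤n π

  private
    n = ℕ.suc n-1

    Adjacent : ℕ → ℕ → Set
    Adjacent x y = adj Γ (vertex x) (vertex y) ≡ true

    a : ℕ → ℕ → ℤ
    a x y = adjMatrix Γ (vertex x) (vertex y)

    wave : ∀ x y → a (1 ℕ.+ x) y + a (1 ℕ.+ x) (2 ℕ.+ y) ≡ a x (1 ℕ.+ y) + a (2 ℕ.+ x) (1 ℕ.+ y)
    wave x y = begin
      a (1 ℕ.+ x) y + a (1 ℕ.+ x) (2 ℕ.+ y)
        ≡⟨ ⊗-cycleMatrix (adjMatrix Γ) (vertex (1 ℕ.+ x)) y ⟨
      (adjMatrix Γ ⊗ cycleMatrix π) (vertex (1 ℕ.+ x)) (vertex (1 ℕ.+ y))
        ≡⟨ commutes _ _ ⟩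
      (cycleMatrix π ⊗ adjMatrix Γ) (vertex (1 ℕ.+ x)) (vertex (1 ℕ.+ y))
        ≡⟨ cycleMatrix-⊗ (adjMatrix Γ) x (vertex (1 ℕ.+ y)) ⟩
      a x (1 ℕ.+ y) + a (2 ℕ.+ x) (1 ℕ.+ y) ∎
      where open ≡-Reasoning

  open DiscreteWave a wave

  -- `translate` only moves labels upwards, so the target y is replaced by the representative x * n
  -- + y, which is at least x.
  rotate : ∀ i x y → Adjacent x (i ℕ.+ i ℕ.+ x) → Adjacent y (i ℕ.+ i ℕ.+ y)
  rotate i x y xk = begin
    adj Γ (vertex y) (vertex (k ℕ.+ y))
      ≡⟨ cong₂ (adj Γ) (vertex-periodic x y) (vertex-+-congˡ k (x ℕ.* n ℕ.+ y) y (vertex-periodic x y)) ⟨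
    adj Γ (vertex (x ℕ.* n ℕ.+ y)) (vertex (k ℕ.+ (x ℕ.* n ℕ.+ y)))
      ≡⟨ cong (λ z → adj Γ (vertex z) (vertex (k ℕ.+ z))) (rearrange x n-1 y) ⟩
    adj Γ (vertex (j ℕ.+ x)) (vertex (k ℕ.+ (j ℕ.+ x)))
      ≡⟨ boolℤ-injective (translate (λ z → cong boolℤ (irrefl Γ (vertex z))) i j x) ⟩
    adj Γ (vertex x) (vertex (k ℕ.+ x))
      ≡⟨ xk ⟩
    true ∎
    where
    open ≡-Reasoning
    k = i ℕ.+ i
    j = x ℕ.* n-1 ℕ.+ y
    rearrange : ∀ x m y → x ℕ.* ℕ.suc m ℕ.+ y ≡ x ℕ.* m ℕ.+ y ℕ.+ x
    rearrange = ℕ-Solver.solve-∀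

  -- The step-k wave equation moves a third edge k ~ k + w to k + k ~ w or k + k ~ k + (k + w).
  no-even-edge : ∀ i x → ¬ Adjacent x (i ℕ.+ i ℕ.+ x)
  no-even-edge i x xk
    -- By `rotate` the argument can be run at label k; the excluded labels 0 and 2k are k - k and k
    -- + k.
    with thirdNeighbour Γ regular 3≤d
           (vertex (i ℕ.+ i)) (vertex 0) (vertex (i ℕ.+ i ℕ.+ (i ℕ.+ i)))
  ... | z , kz , z≢0 , z≢2k =
    no4Cycle ([ below , above ]′ (boolℤ-sum
      (adj Γ (vertex (k ℕ.+ (k ℕ.+ k))) (vertex (k ℕ.+ w))) {adj Γ (vertex k) (vertex (k ℕ.+ w))}
      (adj Γ (vertex (k ℕ.+ k)) (vertex w)) {adj Γ (vertex (k ℕ.+ k)) (vertex (k ℕ.+ (k ℕ.+ w)))}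
      (rectangle k k k w) k~k+w))
    where
    k = i ℕ.+ i
    -- The label of z minus k, with `k * n-1` standing for -k modulo n.
    w = k ℕ.* n-1 ℕ.+ position z

    k+w≡z : vertex (k ℕ.+ w) ≡ z
    k+w≡z = begin
      vertex (k ℕ.+ w)                   ≡⟨ cong vertex (rearrange k n-1 (position z)) ⟩
      vertex (k ℕ.* n ℕ.+ position z)    ≡⟨ vertex-periodic k (position z) ⟩
      vertex (position z)                ≡⟨ vertex-position z ⟩
      z                                  ∎
      where
      open ≡-Reasoning
      rearrange : ∀ k m p → k ℕ.+ (k ℕ.* m ℕ.+ p) ≡ k ℕ.* ℕ.suc m ℕ.+ p
      rearrange = ℕ-Solver.solve-∀

    flip : ∀ {x y} → Adjacent x y → Adjacent y x
    flip {x} {y} xy = trans (sym Γ (vertex y) (vertex x)) xy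

    k~k+w : Adjacent k (k ℕ.+ w)
    k~k+w = trans (cong (adj Γ (vertex k)) k+w≡z) kz

    2k≢k+w : vertex (k ℕ.+ k) ≢ vertex (k ℕ.+ w)
    2k≢k+w eq = z≢2k (≡.sym (trans eq k+w≡z))

    -- The cycle k, 2k, w, k + w. If k and w were the same vertex, then so would be 2k and k + w, so
    -- z ≠ 2k settles both diagonals.
    below : Adjacent (k ℕ.+ k) w → HasCycleOfLength Γ 4
    below 2k~w = fourCycle Γ (rotate i x k xk) 2k~w (rotate i x w xk) (flip {k} {k ℕ.+ w} k~k+w)
      (2k≢k+w ∘ vertex-+-congˡ k k w) 2k≢k+w

    -- The cycle k, 2k, 2k + w, k + w. Cancelling k shows that its first diagonal could degenerate
    -- only if z had label 0.
    above : Adjacent (k ℕ.+ k) (k ℕ.+ (k ℕ.+ w)) → HasCycleOfLength Γ 4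
    above 2k~2k+w = fourCycle Γ (rotate i x k xk) 2k~2k+w
      (flip {k ℕ.+ w} {k ℕ.+ (k ℕ.+ w)} (rotate i x (k ℕ.+ w) xk)) (flip {k} {k ℕ.+ w} k~k+w)
      k≢2k+w 2k≢k+w
      where
      k≢2k+w : vertex k ≢ vertex (k ℕ.+ (k ℕ.+ w))
      k≢2k+w eq = z≢0 (trans (≡.sym k+w≡z) (≡.sym (vertex-+-cancelˡ k 0 (k ℕ.+ w)
        (trans (cong vertex (ℕ.+-identityʳ k)) eq))))

  -- For odd n parity is not defined on residues, but `no-even-edge` speaks of natural labels and so
  -- applies to the representatives below n. Symmetry of Γ covers either order of the positions.
  edge⇒oppositeParity : ∀ i j → adj Γ i j ≡ true → parity (position i) ≢ parity (position j)
  edge⇒oppositeParity i j ij same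
    with sameParity⇒evenOffset (position i) (position j) same
  ... | inj₁ (h , j≡) = no-even-edge h (position i) (trans
    (cong₂ (adj Γ) (vertex-position i) (trans (cong vertex (≡.sym j≡)) (vertex-position j))) ij)
  ... | inj₂ (h , i≡) = no-even-edge h (position j) (trans
    (cong₂ (adj Γ) (vertex-position j) (trans (cong vertex (≡.sym i≡)) (vertex-position i)))
    (trans (sym Γ j i) ij))

theorem5 : (n d : ℕ) → 3 ≤ d → (d % 3 ≡ 0 ⊎ d % 3 ≡ 2) →
    (Γ : Graph n) → ¬ CyclicExcess Γ d 7
theorem5 (ℕ.suc _) d _ _ Γ (3≤n , regular , 3≤d , (cycle , noShorter) , _ , _ , π , excess) =
  -- The colour is the parity of the position on the cycle of B. Girth 7 rules out 4-cycles, and the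
  -- index 3 below is 7 / 2.
  bipartite⇒no7Cycle Γ (λ i → parity (toℕ (π ⟨$⟩ʳ i)))
    (edge⇒oppositeParity 3≤n Γ π regular 3≤d (noShorter 4 (ℕ.s≤s (ℕ.s≤s (ℕ.s≤s (ℕ.s≤s (ℕ.s≤s ℕ.z≤n))))))
      (commutes-cycleMatrix 3 Γ π regular excess))
    cycle
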